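{- For all graphs $G_1, G_2$ and all integers $k \geq 2$, $$\alpha_k(G_1 \cdot G_2) = \alpha_k(G_1) + \iota(G_1)\,(\alpha_k(G_2) - 1),$$ where $\iota(G_1)$ denotes the number of isolated vertices of $G_1$.
   Context: Graphs are finite, simple, undirected and have at least one vertex. For a graph $G$, $\delta_G(u,v)$ is the length of a shortest path between vertices $u$ and $v$ in $G$ (equal to $\infty$ if there is none). A set $S \subseteq V(G)$ is $k$-independent if $\delta_G(u,v) > k$ for all distinct $u,v \in S$; $\alpha_k(G)$ denotes the maximum size of a $k$-independent set in $G$. An isolated vertex is a vertex of degree $0$. The lexicographic product $G_1 \cdot G_2$ has vertex set $V(G_1)\times V(G_2)$, and $(u_1,u_2),(v_1,v_2)$ are adjacent if and only if $(u_1,v_1)\in E(G_1)$, or $u_1=v_1$ and $(u_2,v_2)\in E(G_2)$. -}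

module Defs where

open import Data.Fin.Base using (Fin)
open import Data.Fin.Properties using (any?; injective⇒≤; *↔×)
import Data.Fin.Properties as Fin
open import Data.List.Base using (List; []; _∷_; length; lookup; filter; map; allFin)
open import Data.List.Membership.Propositional using (_∈_)
open import Data.List.Membership.Propositional.Properties using (∈-lookup)
import Data.List.Relation.Unary.All as All
open import Data.List.Relation.Unary.AllPairs using (allPairs?; []; _∷_)
open import Data.List.Relation.Unary.Unique.Propositional using (Unique)
open import Data.Nat.Base using (ℕ; zero; suc; _*_; _≤_; _<_; NonZero; s≤s⁻¹)
open import Data.Nat.Properties
  using (_≟_; _<?_; ≮⇒≥; ≤∧≢⇒<; m<1+n⇒m<n∨m≡n; m*n≢0)
open import Data.Product.Base using (∃; ∃-syntax; _×_; _,_; proj₁; proj₂)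
open import Data.Product.Function.NonDependent.Propositional using (_×-↔_)
open import Data.Sum.Base using (_⊎_; inj₁; inj₂)
open import Function.Base using (_∘_)
open import Function.Bundles using (_↔_; Inverse; Injection)
open import Function.Construct.Composition using (_↔-∘_)
open import Function.Construct.Symmetry using (↔-sym)
open import Function.Properties.Inverse using (↔⇒↣)
open import Relation.Binary.Construct.Add.Supremum.Strict _<_ using (_<⁺_; <⁺-dec)
open import Relation.Binary.Core using (Rel)
open import Relation.Binary.Definitions using (Decidable; DecidableEquality; Irreflexive; Symmetric)
open import Relation.Binary.PropositionalEquality using (_≡_; _≢_; refl; sym; cong; subst)
open import Relation.Nullary using (¬_; Dec; yes; no; contradiction)
open import Relation.Nullary.Construct.Add.Supremum using (_⁺; [_]; ⊤⁺)
open import Relation.Nullary.Decidable using (map′; via-injection; ¬?; _×-dec_; _⊎-dec_; _→-dec_)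
import Relation.Unary as U
open import Level using (0ℓ)

-- Finiteness and decidable adjacency are part of the data, as they must be
-- constructively.  `Adj u v` may have several proofs; only whether it is
-- inhabited is ever used, so this does not introduce multiple edges.

record Graph : Set₁ where
  field
    V        : Set
    order    : ℕ
    nonEmpty : NonZero order
    finite   : V ↔ Fin order
    Adj      : Rel V 0ℓ
    adj?     : Decidable Adj
    irrefl   : Irreflexive _≡_ Adj
    symm     : Symmetric Adj

  _≟ᵛ_ : DecidableEquality V
  _≟ᵛ_ = via-injection (↔⇒↣ finite) Fin._≟_

  vertexList : List V
  vertexList = map (Inverse.from finite) (allFin order)

  degree : V → ℕ
  degree v = length (filter (adj? v) vertexList)

  Isolated : V → Set
  Isolated v = degree v ≡ 0

  infixr 5 _∷_

  data Walk : V → V → Set where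
    []  : ∀ {u} → Walk u u
    _∷_ : ∀ {u v w} → Adj u v → Walk v w → Walk u w

  walkLength : ∀ {u v} → Walk u v → ℕ
  walkLength []      = 0
  walkLength (_ ∷ p) = suc (walkLength p)

  walkVertices : ∀ {u v} → Walk u v → List V
  walkVertices {u} []      = u ∷ []
  walkVertices {u} (_ ∷ p) = u ∷ walkVertices p

  IsPath : ∀ {u v} → Walk u v → Set
  IsPath p = Unique (walkVertices p)

  -- ⊤⁺ plays the role of ∞.
  IsDistance : V → V → ℕ ⁺ → Set
  IsDistance u v [ d ] = (∃[ p ] IsPath {u} {v} p × walkLength p ≡ d)
                       × (∀ (p : Walk u v) → IsPath p → d ≤ walkLength p)
  IsDistance u v ⊤⁺    = ∀ (p : Walk u v) → ¬ IsPath p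

ι : Graph → ℕ
ι G = length (filter (λ v → degree v ≟ 0) vertexList)
  where open Graph G

infixl 7 _·_

_·_ : Graph → Graph → Graph
G₁ · G₂ = record
  { V        = G₁.V × G₂.V
  ; order    = G₁.order * G₂.order
  ; nonEmpty = m*n≢0 G₁.order G₂.order {{G₁.nonEmpty}} {{G₂.nonEmpty}}
  ; finite   = ↔-sym *↔× ↔-∘ (G₁.finite ×-↔ G₂.finite)
  ; Adj      = λ (u₁ , u₂) (v₁ , v₂) → G₁.Adj u₁ v₁ ⊎ (u₁ ≡ v₁ × G₂.Adj u₂ v₂)
  ; adj?     = λ (u₁ , u₂) (v₁ , v₂) →
                 G₁.adj? u₁ v₁ ⊎-dec ((u₁ G₁.≟ᵛ v₁) ×-dec G₂.adj? u₂ v₂)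
  ; irrefl   = λ { refl (inj₁ e)       → G₁.irrefl refl e
                 ; refl (inj₂ (_ , e)) → G₂.irrefl refl e }
  ; symm     = λ { (inj₁ e)        → inj₁ (G₁.symm e)
                 ; (inj₂ (eq , e)) → inj₂ (sym eq , G₂.symm e) }
  }
  where
  module G₁ = Graph G₁
  module G₂ = Graph G₂

module _ {P : ℕ → Set} (P? : U.Decidable P) where

  least-below : ∀ n → (∃[ m ] P m × (∀ {i} → P i → m ≤ i)) ⊎ (∀ {i} → i < n → ¬ P i)
  least-below zero = inj₂ λ ()
  least-below (suc n) with least-below n
  ... | inj₁ found = inj₁ found
  ... | inj₂ none with P? n
  ...   | yes pn = inj₁ (n , pn , λ pi → ≮⇒≥ λ i<n → none i<n pi)
  ...   | no ¬pn = inj₂ λ i<1+n pi → none-at (m<1+n⇒m<n∨m≡n i<1+n) pi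
    where
    none-at : ∀ {i} → i < n ⊎ i ≡ n → ¬ P i
    none-at (inj₁ i<n)  = none i<n
    none-at (inj₂ refl) = ¬pn

  greatest-upto : P 0 → ∀ n → (∀ {i} → P i → i ≤ n) → ∃[ m ] P m × (∀ {i} → P i → i ≤ m)
  greatest-upto p0 n bound with P? n
  ... | yes pn = n , pn , bound
  greatest-upto p0 zero    bound | no ¬pn = contradiction p0 ¬pn
  greatest-upto p0 (suc n) bound | no ¬pn =
    greatest-upto p0 n λ pi → s≤s⁻¹ (≤∧≢⇒< (bound pi) λ { refl → ¬pn pi })

module _ (G : Graph) where
  open Graph G

  anyVertex? : {P : V → Set} → U.Decidable P → Dec (∃ P)
  anyVertex? {P} P? = map′ (λ (i , p) → Inverse.from finite i , p)
                           (λ (v , p) → Inverse.to finite v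
                                      , subst P (sym (Inverse.strictlyInverseʳ finite v)) p)
                           (any? (P? ∘ Inverse.from finite))

  anyList? : {Q : List V → Set} → U.Decidable Q → ∀ d → Dec (∃[ S ] Q S × length S ≡ d)
  anyList? Q? zero    = map′ (λ q → [] , q , refl) (λ { ([] , q , _) → q }) (Q? [])
  anyList? Q? (suc d) =
    map′ (λ { (v , S , q , refl) → v ∷ S , q , refl })
         (λ { (v ∷ S , q , refl) → v , S , q , refl })
         (anyVertex? λ v → anyList? (Q? ∘ (v ∷_)) d)

  anyWalk? : {Q : List V → Set} → U.Decidable Q → ∀ u v d →
             Dec (∃[ p ] Q (walkVertices {u} {v} p) × walkLength p ≡ d)
  anyWalk? Q? u v zero with u ≟ᵛ v
  ... | yes refl = map′ (λ q → [] , q , refl) (λ { ([] , q , _) → q }) (Q? (u ∷ []))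
  ... | no u≢v   = no λ { ([] , _) → u≢v refl }
  anyWalk? Q? u v (suc d) =
    map′ (λ { (w , e , p , q , refl) → e ∷ p , q , refl })
         (λ { (e ∷ p , q , refl) → _ , e , p , q , refl })
         (anyVertex? λ w → adj-×? w)
    where
    adj-×? : ∀ w → Dec (Adj u w × ∃[ p ] _ × walkLength {w} {v} p ≡ d)
    adj-×? w = adj? u w ×-dec anyWalk? (Q? ∘ (u ∷_)) w v d

  unique? : U.Decidable (Unique {A = V})
  unique? = allPairs? λ u v → ¬? (u ≟ᵛ v)

  lookup-injective : ∀ {S : List V} → Unique S → ∀ i j → lookup S i ≡ lookup S j → i ≡ j
  lookup-injective (_ ∷ _)   Fin.zero    Fin.zero    _  = refl
  lookup-injective (_ ∷ uS)  (Fin.suc i) (Fin.suc j) eq = cong Fin.suc (lookup-injective uS i j eq)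
  lookup-injective {_ ∷ S} (v∉S ∷ _) Fin.zero (Fin.suc j) eq =
    contradiction eq (All.lookup v∉S (∈-lookup {xs = S} j))
  lookup-injective {_ ∷ S} (v∉S ∷ _) (Fin.suc i) Fin.zero eq =
    contradiction (sym eq) (All.lookup v∉S (∈-lookup {xs = S} i))

  unique⇒length≤order : ∀ {S : List V} → Unique S → length S ≤ order
  unique⇒length≤order {S} uS =
    injective⇒≤ {f = Inverse.to finite ∘ lookup S}
      λ {i} {j} eq → lookup-injective uS i j (Injection.injective (↔⇒↣ finite) eq)

  length-walkVertices : ∀ {u v} (p : Walk u v) → length (walkVertices p) ≡ suc (walkLength p)
  length-walkVertices []      = refl
  length-walkVertices (_ ∷ p) = cong suc (length-walkVertices p)

  path-length< : ∀ {u v} (p : Walk u v) → IsPath p → walkLength p < order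
  path-length< p uS = subst (_≤ order) (length-walkVertices p) (unique⇒length≤order uS)

  distance : ∀ u v → ∃[ d ] IsDistance u v d
  distance u v with least-below (anyWalk? unique? u v) order
  ... | inj₁ (d , path , least) = [ d ] , path , λ p uS → least (p , uS , refl)
  ... | inj₂ none               = ⊤⁺ , λ p uS → none (path-length< p uS) (p , uS , refl)

  δ : V → V → ℕ ⁺
  δ u v = proj₁ (distance u v)

  KIndependent : ℕ → List V → Set
  KIndependent k S = ∀ {u v} → u ∈ S → v ∈ S → u ≢ v → [ k ] <⁺ δ u v

  kIndependent? : ∀ k → U.Decidable (KIndependent k)
  kIndependent? k S =
    map′ (λ all u∈S v∈S → All.lookup (All.lookup all u∈S) v∈S)
         (λ ind → All.tabulate λ u∈S → All.tabulate λ v∈S → ind u∈S v∈S)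
         (All.all? (λ u → All.all? (λ v → ¬? (u ≟ᵛ v) →-dec <⁺-dec _<?_ [ k ] (δ u v)) S) S)

  -- A set of vertices is a duplicate-free list, and its size is the length.
  IsKIndependentSet : ℕ → List V → Set
  IsKIndependentSet k S = Unique S × KIndependent k S

  IsMaximumSize : ℕ → ℕ → Set
  IsMaximumSize k a = (∃[ S ] IsKIndependentSet k S × length S ≡ a)
                    × (∀ S → IsKIndependentSet k S → length S ≤ a)

  maximumSize : ∀ k → ∃[ a ] IsMaximumSize k a
  maximumSize k with
    greatest-upto (anyList? (λ S → unique? S ×-dec kIndependent? k S))
                  ([] , ([] , λ ()) , refl) order
                  (λ { (_ , (uS , _) , refl) → unique⇒length≤order uS })
  ... | a , set , greatest = a , set , λ S ind → greatest (S , ind , refl)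

α : ℕ → Graph → ℕ
α k G = proj₁ (maximumSize G k)

{-# OPTIONS --safe #-}
module Submission where

-- If u is not isolated in G₁, two vertices of the fibre over u are at distance at
-- most 2 ≤ k, so a k-independent set of G₁ · G₂ meets that fibre at most once; if u is
-- isolated, the fibre is a union of components, isomorphic to G₂.  Between different
-- fibres distances are those of G₁.  Hence an optimal set consists of one vertex over
-- each non-isolated vertex of an optimal set of G₁, which may be taken to contain all
-- isolated vertices, and of an optimal set of G₂ in each fibre over an isolated vertex.

open import Defs
open import Data.Nat.Base using (ℕ; _≥_)
open import Data.Integer.Base using (+_; _+_; _*_; _-_; 1ℤ)
open import Relation.Binary.PropositionalEquality using (_≡_)

open import Data.Bool.Base using (true; false)
open import Data.Fin.Base using (fromℕ<)
open import Data.Fin.Properties using (injective⇒≤)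
import Data.Integer.Properties as ℤ
open import Data.Integer.Tactic.RingSolver using (solve-∀)
open import Data.List.Base
  using (List; []; _∷_; _++_; length; lookup; filter; map; cartesianProduct)
open import Data.List.Membership.Propositional using (_∈_)
open import Data.List.Membership.Propositional.Properties
  using (∈-map⁺; ∈-map⁻; ∈-++⁺ˡ; ∈-++⁺ʳ; ∈-++⁻; ∈-filter⁺; ∈-filter⁻; ∈-allFin; ∈-lookup;
         ∈-cartesianProduct⁻)
open import Data.List.Properties using (length-++; length-map; filter-none)
open import Data.List.Relation.Binary.Subset.Propositional using (_⊆_)
import Data.List.Relation.Unary.All as All
import Data.List.Relation.Unary.All.Properties as All
open import Data.List.Relation.Unary.AllPairs using ([]; _∷_)
open import Data.List.Relation.Unary.Any using (here; there; index)
open import Data.List.Relation.Unary.Any.Properties using (lookup-index)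
open import Data.List.Relation.Unary.Unique.Propositional using (Unique)
import Data.List.Relation.Unary.Unique.Propositional.Properties as Unique
import Data.Nat.Base as ℕ
open import Data.Nat.Base using (suc; _≤_; _<_; z≤n; s≤s)
import Data.Nat.Properties as ℕ
open import Data.Product.Base using (∃-syntax; _×_; _,_; proj₁; proj₂)
open import Data.Sum.Base using (_⊎_; inj₁; inj₂; [_,_]′)
open import Function.Base using (_∘_; case_of_)
open import Function.Bundles using (Inverse; Injection)
open import Function.Construct.Symmetry using (↔-sym)
open import Function.Properties.Inverse using (↔⇒↣)
open import Relation.Binary.Construct.Add.Supremum.Strict _<_ using (_<⁺_; [_]; [_]<⊤⁺)
open import Relation.Binary.PropositionalEquality
  using (_≢_; refl; sym; trans; cong; cong₂; subst; subst₂; module ≡-Reasoning)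
open import Relation.Nullary using (¬_; does; yes; no; contradiction)
open import Relation.Nullary.Construct.Add.Supremum using ([_]; ⊤⁺)
open import Relation.Nullary.Decidable using (¬?)
import Relation.Unary as U

open Graph

-- Counting in lists without repetition.

length-cartesianProduct : ∀ {A B : Set} (xs : List A) (ys : List B) →
                          length (cartesianProduct xs ys) ≡ length xs ℕ.* length ys
length-cartesianProduct []       ys = refl
length-cartesianProduct (x ∷ xs) ys = trans (length-++ (map (x ,_) ys))
  (cong₂ ℕ._+_ (length-map (x ,_) ys) (length-cartesianProduct xs ys))

length-filter-¬? : ∀ {A : Set} {P : A → Set} (P? : U.Decidable P) xs →
                   length xs ≡ length (filter P? xs) ℕ.+ length (filter (¬? ∘ P?) xs)
length-filter-¬? P? []       = refl
length-filter-¬? P? (x ∷ xs) with does (P? x)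
... | true  = cong suc (length-filter-¬? P? xs)
... | false = trans (cong suc (length-filter-¬? P? xs)) (sym (ℕ.+-suc _ _))

-- Injectivity is asked only on entries of `S`, because the projections of a product are injective
-- only on suitable sets.
map-unique : ∀ {A B : Set} (f : A → B) {S} → Unique S →
             (∀ {x y} → x ∈ S → y ∈ S → x ≢ y → f x ≢ f y) → Unique (map f S)
map-unique f []         inj = []
map-unique f (x∉S ∷ uS) inj =
  All.map⁺ (All.tabulate λ y∈S → inj (here refl) (there y∈S) (All.lookup x∉S y∈S)) ∷
  map-unique f uS λ x∈S y∈S → inj (there x∈S) (there y∈S)

-- Isolated vertices of a single graph.

module _ (G : Graph) where

  open import Data.List.Membership.DecPropositional (_≟ᵛ_ G) using (_∈?_)

  isolated? : U.Decidable (Isolated G)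
  isolated? v = degree G v ℕ.≟ 0

  isolatedVertices : List (V G)
  isolatedVertices = filter isolated? (vertexList G)

  someVertex : V G
  someVertex = Inverse.from (finite G) (fromℕ< (ℕ.>-nonZero⁻¹ (order G) {{nonEmpty G}}))

  ∈-vertexList : ∀ v → v ∈ vertexList G
  ∈-vertexList v = subst (_∈ vertexList G) (Inverse.strictlyInverseʳ (finite G) v)
    (∈-map⁺ (Inverse.from (finite G)) (∈-allFin (Inverse.to (finite G) v)))

  isolatedVertices-unique : Unique isolatedVertices
  isolatedVertices-unique = Unique.filter⁺ isolated?
    (Unique.map⁺ (Injection.injective (↔⇒↣ (↔-sym (finite G)))) (Unique.allFin⁺ (order G)))

  ∈-isolatedVertices⁺ : ∀ {v} → Isolated G v → v ∈ isolatedVertices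
  ∈-isolatedVertices⁺ = ∈-filter⁺ isolated? (∈-vertexList _)

  ∈-isolatedVertices⁻ : ∀ {v} → v ∈ isolatedVertices → Isolated G v
  ∈-isolatedVertices⁻ = proj₂ ∘ ∈-filter⁻ isolated? {xs = vertexList G}

  -- A neighbour `v` would be an entry of the filtered list that `degree` counts, so its length
  -- could not be 0.
  isolated⇒¬adj : ∀ {u v} → Isolated G u → ¬ Adj G u v
  isolated⇒¬adj {u} {v} iso e
    with filter (adj? G u) (vertexList G) | ∈-filter⁺ (adj? G u) (∈-vertexList v) e
  isolated⇒¬adj () e | _ ∷ _ | _

  ¬isolated⇒adj : ∀ {u} → ¬ Isolated G u → ∃[ v ] Adj G u v
  ¬isolated⇒adj {u} ¬iso with anyVertex? G (adj? G u)
  ... | yes neighbour = neighbour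
  ... | no none = contradiction
    (cong length (filter-none (adj? G u) (All.universal (λ v e → none (v , e)) (vertexList G)))) ¬iso

  -- Walks, paths and distances.

  walk-from-isolated : ∀ {u v} → Isolated G u → Walk G u v → u ≡ v
  walk-from-isolated iso []      = refl
  walk-from-isolated iso (e ∷ _) = contradiction e (isolated⇒¬adj iso)

  walk-to-isolated : ∀ {u v} → Isolated G v → Walk G u v → u ≡ v
  walk-to-isolated iso []      = refl
  walk-to-isolated iso (e ∷ p) with refl ← walk-to-isolated iso p =
    contradiction (symm G e) (isolated⇒¬adj iso)

  path-suffix : ∀ {u v w} (p : Walk G u v) → IsPath G p → w ∈ walkVertices G p →
                ∃[ q ] IsPath G {w} {v} q × walkLength G q ≤ walkLength G p
  path-suffix []      path       (here refl)  = [] , path , z≤n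
  path-suffix (e ∷ p) path       (here refl)  = e ∷ p , path , ℕ.≤-refl
  path-suffix (e ∷ p) (_ ∷ path) (there w∈p) =
    let q , pathq , q≤p = path-suffix p path w∈p in q , pathq , ℕ.m≤n⇒m≤1+n q≤p

  -- Loops are cut out from the end backwards: if `u` already lies on the path found for the tail,
  -- the suffix starting there replaces the whole walk.
  walk⇒path : ∀ {u v} (p : Walk G u v) →
              ∃[ q ] IsPath G {u} {v} q × walkLength G q ≤ walkLength G p
  walk⇒path []      = [] , (All.[] ∷ []) , z≤n
  walk⇒path {u} (e ∷ p) with walk⇒path p
  ... | q , path , q≤p with u ∈? walkVertices G q
  ...   | yes u∈q = let r , pathr , r≤q = path-suffix q path u∈q in
                    r , pathr , ℕ.m≤n⇒m≤1+n (ℕ.≤-trans r≤q q≤p)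
  ...   | no u∉q  = e ∷ q , (All.¬Any⇒All¬ _ u∉q ∷ path) , s≤s q≤p

  -- This is distance greater than `k`, stated through all walks. It treats ∞ uniformly, and walks,
  -- unlike paths, can be projected from a product without losing their defining property.
  Far : ℕ → V G → V G → Set
  Far k u v = ∀ (p : Walk G u v) → k < walkLength G p

  distance⇒far : ∀ {k u v} d → IsDistance G u v d → [ k ] <⁺ d → Far k u v
  distance⇒far [ d ] (_ , least) [ k<d ] p =
    let q , path , q≤p = walk⇒path p in ℕ.<-≤-trans k<d (ℕ.≤-trans (least q path) q≤p)
  distance⇒far ⊤⁺ none _ p = let q , path , _ = walk⇒path p in contradiction path (none q)

  far⇒distance : ∀ {k u v} d → IsDistance G u v d → Far k u v → [ k ] <⁺ d
  far⇒distance [ _ ] ((p , _ , refl) , _) far = [ far p ]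
  far⇒distance ⊤⁺    _                    _   = [ _ ]<⊤⁺

  kIndependent⇒far : ∀ {k S} → KIndependent G k S →
                     ∀ {u v} → u ∈ S → v ∈ S → u ≢ v → Far k u v
  kIndependent⇒far ind {u} {v} u∈S v∈S u≢v =
    distance⇒far _ (proj₂ (distance G u v)) (ind u∈S v∈S u≢v)

  far⇒kIndependent : ∀ {k S} → (∀ {u v} → u ∈ S → v ∈ S → u ≢ v → Far k u v) →
                     KIndependent G k S
  far⇒kIndependent far {u} {v} u∈S v∈S u≢v =
    far⇒distance _ (proj₂ (distance G u v)) (far u∈S v∈S u≢v)

  -- Sizes of k-independent sets and the effect of isolated vertices.

  unique-⊆⇒length≤ : ∀ {S T : List (V G)} → Unique S → S ⊆ T → length S ≤ length T
  unique-⊆⇒length≤ {S} {T} uS S⊆T =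
    -- Pigeonhole: each position in `S` is sent to a position of the same vertex in `T`.
    injective⇒≤ {f = λ i → index (S⊆T (∈-lookup {xs = S} i))}
      λ {i} {j} eq → lookup-injective G uS i j
        (trans (lookup-index (S⊆T (∈-lookup {xs = S} i)))
        (trans (cong (lookup T) eq) (sym (lookup-index (S⊆T (∈-lookup {xs = S} j))))))

  α-attained : ∀ k → ∃[ S ] IsKIndependentSet G k S × length S ≡ α k G
  α-attained k = proj₁ (proj₂ (maximumSize G k))

  α-maximal : ∀ {k S} → IsKIndependentSet G k S → length S ≤ α k G
  α-maximal {k} {S} = proj₂ (proj₂ (maximumSize G k)) S

  filter-isKIndependentSet : ∀ {k S} {P : V G → Set} (P? : U.Decidable P) →
                             IsKIndependentSet G k S → IsKIndependentSet G k (filter P? S)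
  filter-isKIndependentSet P? (uS , ind) =
    Unique.filter⁺ P? uS ,
    λ u∈ v∈ → ind (proj₁ (∈-filter⁻ P? u∈)) (proj₁ (∈-filter⁻ P? v∈))

  -- No walk joins an isolated vertex to a different vertex, so the added vertices are at infinite
  -- distance from everything else.
  addIsolated : ∀ {k S} → (∀ {v} → v ∈ S → ¬ Isolated G v) →
                IsKIndependentSet G k S → IsKIndependentSet G k (S ++ isolatedVertices)
  addIsolated {k} {S} ¬iso (uS , ind) =
    Unique.++⁺ uS isolatedVertices-unique (λ (v∈S , v∈I) → ¬iso v∈S (∈-isolatedVertices⁻ v∈I)) ,
    far⇒kIndependent λ u∈ v∈ → far (∈-++⁻ S u∈) (∈-++⁻ S v∈)
    where
    far : ∀ {u v} → u ∈ S ⊎ u ∈ isolatedVertices → v ∈ S ⊎ v ∈ isolatedVertices →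
          u ≢ v → Far k u v
    far (inj₁ u∈S) (inj₁ v∈S) u≢v   = kIndependent⇒far ind u∈S v∈S u≢v
    far (inj₂ u∈I) _          u≢v p =
      contradiction (walk-from-isolated (∈-isolatedVertices⁻ u∈I) p) u≢v
    far _          (inj₂ v∈I) u≢v p =
      contradiction (walk-to-isolated (∈-isolatedVertices⁻ v∈I) p) u≢v

  nonIsolated : List (V G) → List (V G)
  nonIsolated = filter (¬? ∘ isolated?)

  nonIsolated-¬isolated : ∀ S {v} → v ∈ nonIsolated S → ¬ Isolated G v
  nonIsolated-¬isolated S = proj₂ ∘ ∈-filter⁻ (¬? ∘ isolated?) {xs = S}

  length≤nonIsolated+ι : ∀ {S} → Unique S → length S ≤ length (nonIsolated S) ℕ.+ ι G
  length≤nonIsolated+ι {S} uS = begin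
    length S                                                ≡⟨ length-filter-¬? isolated? S ⟩
    length (filter isolated? S) ℕ.+ length (nonIsolated S)
      ≤⟨ ℕ.+-monoˡ-≤ _ (unique-⊆⇒length≤ (Unique.filter⁺ isolated? uS) isolated⊆) ⟩
    ι G ℕ.+ length (nonIsolated S)                          ≡⟨ ℕ.+-comm (ι G) _ ⟩
    length (nonIsolated S) ℕ.+ ι G                          ∎
    where
    open ℕ.≤-Reasoning
    isolated⊆ : filter isolated? S ⊆ isolatedVertices
    isolated⊆ = ∈-isolatedVertices⁺ ∘ proj₂ ∘ ∈-filter⁻ isolated? {xs = S}

-- The hypothesis on `f` may use that `u` and `v` are far apart; for the first projection this is
-- exactly what separates the images.
map-isKIndependentSet :
  ∀ G H {k S} (f : V G → V H) → IsKIndependentSet G k S →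
  (∀ {u v} → u ∈ S → v ∈ S → u ≢ v → Far G k u v → f u ≢ f v × Far H k (f u) (f v)) →
  IsKIndependentSet H k (map f S)
map-isKIndependentSet G H {k} {S} f (uS , ind) image =
  map-unique f uS (λ u∈S v∈S u≢v → proj₁ (image′ u∈S v∈S u≢v)) ,
  far⇒kIndependent H λ fu∈ fv∈ fu≢fv → far fu≢fv (∈-map⁻ f fu∈) (∈-map⁻ f fv∈)
  where
  image′ : ∀ {u v} → u ∈ S → v ∈ S → u ≢ v → f u ≢ f v × Far H k (f u) (f v)
  image′ u∈S v∈S u≢v = image u∈S v∈S u≢v (kIndependent⇒far G ind u∈S v∈S u≢v)
  far : ∀ {x y} → x ≢ y → ∃[ u ] u ∈ S × x ≡ f u → ∃[ v ] v ∈ S × y ≡ f v → Far H k x y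
  far fu≢fv (u , u∈S , refl) (v , v∈S , refl) = proj₂ (image′ u∈S v∈S (fu≢fv ∘ cong f))

-- Walks and distances in the lexicographic product.

module _ (G₁ G₂ : Graph) where

  private
    G = G₁ · G₂

  -- An edge of `G₁` allows any change of the second coordinate. The lift stays at `x` until its
  -- last edge, which moves to `y`; hence the walk is given with a first edge `e`.
  liftWalk : ∀ {u w v} (e : Adj G₁ u w) (p : Walk G₁ w v) (x y : V G₂) →
             ∃[ q ] walkLength G {u , x} {v , y} q ≡ suc (walkLength G₁ p)
  liftWalk e []       x y = inj₁ e ∷ [] , refl
  liftWalk e (e′ ∷ p) x y = let q , eq = liftWalk e′ p x y in inj₁ e ∷ q , cong suc eq

  -- Steps inside a fibre disappear under projection, so the length can only drop.
  projectWalk : ∀ {a b} (p : Walk G a b) →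
                ∃[ q ] walkLength G₁ {proj₁ a} {proj₁ b} q ≤ walkLength G p
  projectWalk []                    = [] , z≤n
  projectWalk (inj₁ e ∷ p)          = let q , q≤p = projectWalk p in e ∷ q , s≤s q≤p
  projectWalk (inj₂ (refl , _) ∷ p) = let q , q≤p = projectWalk p in q , ℕ.m≤n⇒m≤1+n q≤p

  fibreWalk⁺ : ∀ u {x y} (p : Walk G₂ x y) →
               ∃[ q ] walkLength G {u , x} {u , y} q ≡ walkLength G₂ p
  fibreWalk⁺ u []      = [] , refl
  fibreWalk⁺ u (e ∷ p) = let q , eq = fibreWalk⁺ u p in inj₂ (refl , e) ∷ q , cong suc eq

  -- A walk can leave a fibre only along an edge of `G₁`, and there is none at an isolated vertex;
  -- so every step is an edge of `G₂`.
  fibreWalk⁻ : ∀ {a b} → Isolated G₁ (proj₁ a) → (p : Walk G a b) →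
               ∃[ q ] walkLength G₂ {proj₂ a} {proj₂ b} q ≡ walkLength G p
  fibreWalk⁻ iso []                    = [] , refl
  fibreWalk⁻ iso (inj₁ e ∷ _)          = contradiction e (isolated⇒¬adj G₁ iso)
  fibreWalk⁻ iso (inj₂ (refl , e) ∷ p) =
    let q , eq = fibreWalk⁻ iso p in e ∷ q , cong suc eq

  far-proj₁ : ∀ {k u v x y} → u ≢ v → Far G k (u , x) (v , y) → Far G₁ k u v
  far-proj₁ u≢v far []      = contradiction refl u≢v
  far-proj₁ u≢v far (e ∷ p) = let q , eq = liftWalk e p _ _ in subst (_ <_) eq (far q)

  far-lift : ∀ {k a b} → Far G₁ k (proj₁ a) (proj₁ b) → Far G k a b
  far-lift far p = let q , q≤p = projectWalk p in ℕ.<-≤-trans (far q) q≤p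

  far-proj₂ : ∀ {k u x y} → Far G k (u , x) (u , y) → Far G₂ k x y
  far-proj₂ far p = let q , eq = fibreWalk⁺ _ p in subst (_ <_) eq (far q)

  far-fibre : ∀ {k u x y} → Isolated G₁ u → Far G₂ k x y → Far G k (u , x) (u , y)
  far-fibre iso far p = let q , eq = fibreWalk⁻ iso p in subst (_ <_) eq (far q)

  -- A non-isolated u has a neighbour w, and (u , x), (w , x), (u , y) is a walk of length 2.
  ¬far-fibre : ∀ {k u x y} → k ≥ 2 → ¬ Isolated G₁ u → ¬ Far G k (u , x) (u , y)
  ¬far-fibre {x = x} k≥2 ¬iso far =
    let w , e = ¬isolated⇒adj G₁ ¬iso
    in ℕ.<⇒≱ (far (_∷_ {v = w , x} (inj₁ e) (inj₁ (symm G₁ e) ∷ []))) k≥2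

  -- Upper and lower bounds for the product.

  module _ (k : ℕ) where

    -- Walks of `G₂` embed in the fibre with the same length, so the second projection keeps
    -- vertices of one fibre distinct and far apart.
    fibre-bound : ∀ {S u} → IsKIndependentSet G k S → (∀ {a} → a ∈ S → proj₁ a ≡ u) →
                  length S ≤ α k G₂
    fibre-bound {S} ind inFibre = subst (_≤ α k G₂) (length-map proj₂ S)
      (α-maximal G₂ (map-isKIndependentSet G G₂ proj₂ ind image))
      where
      image : ∀ {a b} → a ∈ S → b ∈ S → a ≢ b → Far G k a b →
              proj₂ a ≢ proj₂ b × Far G₂ k (proj₂ a) (proj₂ b)
      image a∈S b∈S a≢b far with refl ← inFibre a∈S | refl ← inFibre b∈S =
        a≢b ∘ cong (_ ,_) , far-proj₂ far

    fibres-bound : ∀ us {S} → IsKIndependentSet G k S → (∀ {a} → a ∈ S → proj₁ a ∈ us) →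
                   length S ≤ length us ℕ.* α k G₂
    fibres-bound []       (uS , _) S⊆ = unique-⊆⇒length≤ G {T = []} uS λ a∈S → case S⊆ a∈S of λ ()
    fibres-bound (u ∷ us) {S} ind S⊆ = begin
      length S                         ≡⟨ length-filter-¬? inFibre? S ⟩
      length fibre ℕ.+ length rest     ≤⟨ ℕ.+-mono-≤
        (fibre-bound (filter-isKIndependentSet G inFibre? ind)
          (proj₂ ∘ ∈-filter⁻ inFibre? {xs = S}))
        (fibres-bound us (filter-isKIndependentSet G (¬? ∘ inFibre?) ind) rest⊆) ⟩
      α k G₂ ℕ.+ length us ℕ.* α k G₂  ∎
      where
      open ℕ.≤-Reasoning
      inFibre? : U.Decidable (λ (a : V G) → proj₁ a ≡ u)
      inFibre? a = _≟ᵛ_ G₁ (proj₁ a) u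
      fibre  = filter inFibre? S
      rest   = filter (¬? ∘ inFibre?) S
      rest⊆ : ∀ {a} → a ∈ rest → proj₁ a ∈ us
      rest⊆ a∈ with ∈-filter⁻ (¬? ∘ inFibre?) {xs = S} a∈
      ... | a∈S , a≢u with S⊆ a∈S
      ...   | here a≡u   = contradiction a≡u a≢u
      ...   | there a∈us = a∈us

    -- Split `S` into `M`, over isolated vertices, and `N`. The projection of `N` together with all
    -- isolated vertices is k-independent in `G₁`, which bounds `length N` plus `ι G₁`; `M` is
    -- bounded fibre by fibre.
    product-upper : k ≥ 2 → ∀ {S} → IsKIndependentSet G k S →
                    length S ℕ.+ ι G₁ ≤ α k G₁ ℕ.+ ι G₁ ℕ.* α k G₂
    product-upper k≥2 {S} ind = begin
      length S ℕ.+ ι G₁                                 ≡⟨ cong (ℕ._+ ι G₁) (length-filter-¬? overIsolated? S) ⟩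
      length M ℕ.+ length N ℕ.+ ι G₁                    ≡⟨ ℕ.+-assoc (length M) _ _ ⟩
      length M ℕ.+ (length N ℕ.+ ι G₁)                  ≡⟨ ℕ.+-comm (length M) _ ⟩
      length N ℕ.+ ι G₁ ℕ.+ length M                    ≡⟨ cong (λ n → n ℕ.+ ι G₁ ℕ.+ length M) (length-map proj₁ N) ⟨
      length (map proj₁ N) ℕ.+ ι G₁ ℕ.+ length M        ≡⟨ cong (ℕ._+ length M) (length-++ (map proj₁ N)) ⟨
      length (map proj₁ N ++ isolatedVertices G₁) ℕ.+ length M
        ≤⟨ ℕ.+-mono-≤ (α-maximal G₁ (addIsolated G₁ ¬iso projected))
                      (fibres-bound (isolatedVertices G₁)
                                    (filter-isKIndependentSet G overIsolated? ind) M⊆) ⟩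
      α k G₁ ℕ.+ ι G₁ ℕ.* α k G₂                        ∎
      where
      open ℕ.≤-Reasoning
      overIsolated? : U.Decidable (λ (a : V G) → Isolated G₁ (proj₁ a))
      overIsolated? a = isolated? G₁ (proj₁ a)
      M = filter overIsolated? S
      N = filter (¬? ∘ overIsolated?) S
      N-¬iso : ∀ {a} → a ∈ N → ¬ Isolated G₁ (proj₁ a)
      N-¬iso = proj₂ ∘ ∈-filter⁻ (¬? ∘ overIsolated?) {xs = S}
      M⊆ : ∀ {a} → a ∈ M → proj₁ a ∈ isolatedVertices G₁
      M⊆ = ∈-isolatedVertices⁺ G₁ ∘ proj₂ ∘ ∈-filter⁻ overIsolated? {xs = S}
      image : ∀ {a b} → a ∈ N → b ∈ N → a ≢ b → Far G k a b →
              proj₁ a ≢ proj₁ b × Far G₁ k (proj₁ a) (proj₁ b)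
      image {a} {b} a∈N _ _ far = a₁≢b₁ , far-proj₁ a₁≢b₁ far
        where
        a₁≢b₁ : proj₁ a ≢ proj₁ b
        -- Two vertices over the same non-isolated vertex would be joined by a walk of length 2.
        a₁≢b₁ refl = ¬far-fibre k≥2 (N-¬iso a∈N) far
      projected : IsKIndependentSet G₁ k (map proj₁ N)
      projected = map-isKIndependentSet G G₁ proj₁
        (filter-isKIndependentSet G (¬? ∘ overIsolated?) ind) image
      ¬iso : ∀ {v} → v ∈ map proj₁ N → ¬ Isolated G₁ v
      ¬iso v∈ with a , a∈N , refl ← ∈-map⁻ proj₁ v∈ = N-¬iso a∈N

    -- The witness `T` has one vertex over each non-isolated entry of `S₁` and a copy of `S₂` over
    -- every isolated vertex of `G₁`. Isolated entries of `S₁` number at most `ι G₁`, which the term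
    -- on the right absorbs.
    product-lower : ∀ {S₁ S₂} → IsKIndependentSet G₁ k S₁ → IsKIndependentSet G₂ k S₂ →
                    length S₁ ℕ.+ ι G₁ ℕ.* length S₂ ≤ α k G ℕ.+ ι G₁
    product-lower {S₁} {S₂} ind₁ ind₂ = begin
      length S₁ ℕ.+ ι G₁ ℕ.* length S₂                     ≤⟨ ℕ.+-monoˡ-≤ _ (length≤nonIsolated+ι G₁ (proj₁ ind₁)) ⟩
      length N ℕ.+ ι G₁ ℕ.+ ι G₁ ℕ.* length S₂             ≡⟨ ℕ.+-assoc (length N) _ _ ⟩
      length N ℕ.+ (ι G₁ ℕ.+ ι G₁ ℕ.* length S₂)           ≡⟨ cong (length N ℕ.+_) (ℕ.+-comm (ι G₁) _) ⟩
      length N ℕ.+ (ι G₁ ℕ.* length S₂ ℕ.+ ι G₁)           ≡⟨ ℕ.+-assoc (length N) _ _ ⟨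
      length N ℕ.+ ι G₁ ℕ.* length S₂ ℕ.+ ι G₁             ≡⟨ cong (ℕ._+ ι G₁) length-T ⟨
      length T ℕ.+ ι G₁                                    ≤⟨ ℕ.+-monoˡ-≤ (ι G₁) (α-maximal G T-ind) ⟩
      α k G ℕ.+ ι G₁                                       ∎
      where
      open ℕ.≤-Reasoning
      I  = isolatedVertices G₁
      N  = nonIsolated G₁ S₁
      -- Any vertex serves here; one exists because graphs are nonempty.
      x₀ = someVertex G₂
      T₁ = map (_, x₀) N
      T₂ = cartesianProduct I S₂
      T  = T₁ ++ T₂
      length-T : length T ≡ length N ℕ.+ ι G₁ ℕ.* length S₂
      length-T = trans (length-++ T₁)
        (cong₂ ℕ._+_ (length-map (_, x₀) N) (length-cartesianProduct I S₂))
      N-¬iso : ∀ {v} → v ∈ N → ¬ Isolated G₁ v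
      N-¬iso = nonIsolated-¬isolated G₁ S₁
      N++I-ind : IsKIndependentSet G₁ k (N ++ I)
      N++I-ind = addIsolated G₁ N-¬iso (filter-isKIndependentSet G₁ (¬? ∘ isolated? G₁) ind₁)
      ∈-T⁻ : ∀ {v x} → (v , x) ∈ T → (v ∈ N × x ≡ x₀) ⊎ (v ∈ I × x ∈ S₂)
      ∈-T⁻ a∈T with ∈-++⁻ T₁ a∈T
      ... | inj₂ a∈T₂ = inj₂ (∈-cartesianProduct⁻ I S₂ a∈T₂)
      ... | inj₁ a∈T₁ with _ , v∈N , refl ← ∈-map⁻ (_, x₀) a∈T₁ = inj₁ (v∈N , refl)
      proj₁-∈ : ∀ {v x} → (v , x) ∈ T → v ∈ N ++ I
      proj₁-∈ a∈T = [ ∈-++⁺ˡ ∘ proj₁ , ∈-++⁺ʳ N ∘ proj₁ ]′ (∈-T⁻ a∈T)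
      sameFibre : ∀ {v x y} → (v , x) ∈ T → (v , y) ∈ T → x ≢ y → Far G k (v , x) (v , y)
      sameFibre a∈T b∈T x≢y with ∈-T⁻ a∈T | ∈-T⁻ b∈T
      ... | inj₁ (_ , refl)   | inj₁ (_ , refl)   = contradiction refl x≢y
      ... | inj₁ (v∈N , _)    | inj₂ (v∈I , _)    =
        contradiction (∈-isolatedVertices⁻ G₁ v∈I) (N-¬iso v∈N)
      ... | inj₂ (v∈I , _)    | inj₁ (v∈N , _)    =
        contradiction (∈-isolatedVertices⁻ G₁ v∈I) (N-¬iso v∈N)
      ... | inj₂ (v∈I , x∈S₂) | inj₂ (_ , y∈S₂)   =
        far-fibre (∈-isolatedVertices⁻ G₁ v∈I) (kIndependent⇒far G₂ (proj₂ ind₂) x∈S₂ y∈S₂ x≢y)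
      T-far : ∀ {a b} → a ∈ T → b ∈ T → a ≢ b → Far G k a b
      T-far {u , _} {v , _} a∈T b∈T a≢b with _≟ᵛ_ G₁ u v
      ... | yes refl = sameFibre a∈T b∈T (a≢b ∘ cong (u ,_))
      -- Over different fibres the distance in `G₁` decides, and both first coordinates lie in the
      -- k-independent list `N ++ I`.
      ... | no u≢v   = far-lift
        (kIndependent⇒far G₁ (proj₂ N++I-ind) (proj₁-∈ a∈T) (proj₁-∈ b∈T) u≢v)
      T-ind : IsKIndependentSet G k T
      T-ind =
        Unique.++⁺ (Unique.map⁺ (cong proj₁) (Unique.filter⁺ (¬? ∘ isolated? G₁) (proj₁ ind₁)))
                   (Unique.cartesianProduct⁺ (isolatedVertices-unique G₁) (proj₁ ind₂))
                   disjoint ,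
        far⇒kIndependent G T-far
        where
        disjoint : ∀ {a} → ¬ (a ∈ T₁ × a ∈ T₂)
        disjoint (a∈T₁ , a∈T₂) with _ , v∈N , refl ← ∈-map⁻ (_, x₀) a∈T₁ =
          N-¬iso v∈N (∈-isolatedVertices⁻ G₁ (proj₁ (∈-cartesianProduct⁻ I S₂ a∈T₂)))

    -- Adding `ι G₁` on the left keeps the formula free of subtraction, so both bounds stay in the
    -- natural numbers.
    α-product : k ≥ 2 → α k G ℕ.+ ι G₁ ≡ α k G₁ ℕ.+ ι G₁ ℕ.* α k G₂
    α-product k≥2 =
      let _ , ind  , size  = α-attained G k
          _ , ind₁ , size₁ = α-attained G₁ k
          _ , ind₂ , size₂ = α-attained G₂ k
      in ℕ.≤-antisym
           (subst (λ a → a ℕ.+ ι G₁ ≤ α k G₁ ℕ.+ ι G₁ ℕ.* α k G₂) size (product-upper k≥2 ind))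
           (subst₂ (λ a₁ a₂ → a₁ ℕ.+ ι G₁ ℕ.* a₂ ≤ α k G ℕ.+ ι G₁) size₁ size₂
             (product-lower ind₁ ind₂))

-- Passage to the integers.

subtract-ι : ∀ a i b c → a ℕ.+ i ≡ b ℕ.+ i ℕ.* c → + a ≡ + b + + i * (+ c - 1ℤ)
subtract-ι a i b c eq = begin
  + a                        ≡⟨ cancel (+ a) (+ i) ⟩
  + (a ℕ.+ i) - + i          ≡⟨ cong (λ n → + n - + i) eq ⟩
  + b + + (i ℕ.* c) - + i    ≡⟨ cong (λ n → + b + n - + i) (ℤ.pos-* i c) ⟩
  + b + + i * + c - + i      ≡⟨ rearrange (+ b) (+ i) (+ c) ⟩
  + b + + i * (+ c - 1ℤ)     ∎
  where
  open ≡-Reasoning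
  cancel : ∀ a i → a ≡ a + i - i
  cancel = solve-∀
  rearrange : ∀ b i c → b + i * c - i ≡ b + i * (c - 1ℤ)
  rearrange = solve-∀

theorem5p4 : (G₁ G₂ : Graph) (k : ℕ) → k ≥ 2 →
    + α k (G₁ · G₂) ≡ + α k G₁ + + ι G₁ * (+ α k G₂ - 1ℤ)
theorem5p4 G₁ G₂ k k≥2 =
  subtract-ι (α k (G₁ · G₂)) (ι G₁) (α k G₁) (α k G₂) (α-product G₁ G₂ k k≥2)
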